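{- Let $f:2^V\to\{0,1\}$ be a definite Horn function. Then the following claims are equivalent. (i) $f$ is hypergraph Horn. (ii) $f^\circ=f$. (iii) $f^{ii}=f$, where $f^{ii}=(f^i)^i$. (iv) For every false set $F$ of $f$, there exists an implicate set $I\in\mathcal{I}(f)$ such that $|I\setminus F|=1$. (v) For every false set $F$ of $f$, there exists an implicate set $I\in\mathcal{G}(f)$ such that $|I\setminus F|=1$. (vi) For every false set $F$ of $f$, there exists a variable $u\in\mathbb{T}_f(F)\setminus F$ such that $v\in\mathbb{T}_f((F\setminus\{v\})\cup\{u\})$ holds for every $v\in F$ with $f(F\setminus\{v\})=1$.
   Context: $V$ is a finite set of Boolean variables. A Boolean function on $V$ is a map $f:2^V\to\{0,1\}$ (a subset is identified with its characteristic vector). A set $Z\subseteq V$ is a true set of $f$ if $f(Z)=1$ and a false set if $f(Z)=0$; $\mathcal{T}(f)$ is the family of true sets. Write $f\le g$ ($g$ is a majorant of $f$) if $f(X)\le g(X)$ for all $X\subseteq V$. For $B\subsetneq V$ and $v\in V\setminus B$, the definite Horn clause $B\to v$ is the Boolean function whose true sets are the sets $T$ with $B\not\subseteq T$ or $B\cup\{v\}\subseteq T$. A definite Horn CNF is a finite conjunction of such clauses (the empty conjunction is the constant $1$), and a definite Horn function is a Boolean function representable by a definite Horn CNF; equivalently, $\mathcal{T}(f)$ is closed under intersection and contains $V$. For a definite Horn function $f$ and $Z\subseteq V$, $\mathbb{T}_f(Z)$ denotes the unique smallest true set of $f$ containing $Z$. A clause $B\to v$ is an implicate of a Boolean function $f$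 if $f\le (B\to v)$. A hypergraph is a family $\mathcal{H}\subseteq 2^V$; its associated circular CNF is $\Phi_{\mathcal{H}}=\bigwedge_{H\in\mathcal{H}}\bigwedge_{v\in H}((H\setminus\{v\})\to v)$, identified with the function it represents. A definite Horn function $h$ is hypergraph Horn if $h=\Phi_{\mathcal{H}}$ for some hypergraph $\mathcal{H}\subseteq 2^V$. A set $I\subseteq V$ is an implicate set of a Boolean function $f$ if $(I\setminus\{v\})\to v$ is an implicate of $f$ for all $v\in I$; $\mathcal{I}(f)$ is the family of implicate sets (it contains $\emptyset$ and is closed under unions). The standard generator $\mathcal{G}(f)$ is the unique minimal subfamily of $\mathcal{I}(f)$ whose union closure is $\mathcal{I}(f)$; it consists of those implicate sets that are not the union of other implicate sets (the union of the empty family being $\emptyset$). $f^\circ=\Phi_{\mathcal{I}(f)}$ is the unique minimal hypergraph Horn majorant of $f$. The implicate-dual $f^i$ of a Boolean function $f$ is the Boolean function defined by $\mathcal{T}(f^i)=\{V\setminus I\mid I\in\mathcal{I}(f)\}$. -}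

module Defs where

import Data.Bool.Base as Bool
import Data.Bool.Properties as Boolₚ
open import Data.Bool.Base using (Bool; true; false)
open import Data.Fin.Base using (Fin)
open import Data.Fin.Subset
open import Data.Fin.Subset.Properties
open import Data.List.Base using (List; []; _∷_; _++_; map; filter; concatMap; allFin)
import Data.List.Membership.DecPropositional as DecMembership
open import Data.List.Membership.Propositional using () renaming (_∈_ to _∈ˡ_)
open import Data.List.Membership.Propositional.Properties
  using (∈-map⁺; ∈-++⁺ˡ; ∈-++⁺ʳ; ∈-filter⁺; ∈-filter⁻)
open import Data.List.Relation.Binary.Subset.Propositional using () renaming (_⊆_ to _⊆ˡ_)
open import Data.List.Relation.Unary.All as All using (All)
open import Data.List.Relation.Unary.Any as Any using (here; there)
open import Data.Nat.Base as ℕ using (ℕ; zero; suc)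
open import Data.Nat.Induction using (<-wellFounded)
open import Data.Product.Base using (∃; _×_; _,_; proj₁; proj₂)
open import Data.Product using (∃!)
open import Data.Sum.Base using (_⊎_; inj₁; inj₂)
open import Data.Vec.Base as Vec using ([]; _∷_)
import Data.Vec.Properties as Vecₚ
open import Function.Base using (_∘_)
open import Function.Bundles using (_⇔_; mk⇔; module Equivalence)
open import Induction.WellFounded using (Acc; acc)
open import Relation.Binary.Definitions using (DecidableEquality)
open import Relation.Binary.PropositionalEquality
  using (_≡_; _≢_; _≗_; refl; sym; trans; subst)
open import Relation.Nullary.Decidable using (Dec; yes; no; does; map′; ¬?; _×-dec_; _⊎-dec_; dec-true)
open import Relation.Nullary.Negation using (¬_; contradiction)
open import Relation.Unary using (Pred; Decidable)
open import Level using (0ℓ)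

------------------------------------------------------------------------
-- Finite families of subsets

-- A family 𝓗 ⊆ 2^V, where V = Fin n, is given by a list of its members;
-- only list membership matters, never order or multiplicity.
Hypergraph : ℕ → Set
Hypergraph n = List (Subset n)

allSubsets : ∀ n → Hypergraph n
allSubsets zero    = [] ∷ []
allSubsets (suc n) = map (inside ∷_) (allSubsets n) ++ map (outside ∷_) (allSubsets n)

∈-allSubsets : ∀ {n} (X : Subset n) → X ∈ˡ allSubsets n
∈-allSubsets []            = here refl
∈-allSubsets (inside  ∷ X) = ∈-++⁺ˡ (∈-map⁺ (inside ∷_) (∈-allSubsets X))
∈-allSubsets (outside ∷ X) =
  ∈-++⁺ʳ (map (inside ∷_) (allSubsets _)) (∈-map⁺ (outside ∷_) (∈-allSubsets X))

infix 4 _≟ˢ_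

_≟ˢ_ : ∀ {n} → DecidableEquality (Subset n)
_≟ˢ_ = Vecₚ.≡-dec Boolₚ._≟_

-- The subfamily may be empty, so ⊥ lies in every union closure.
UnionClosure : ∀ {n} → Hypergraph n → Pred (Subset n) 0ℓ
UnionClosure 𝓗 X = ∃ λ 𝓢 → 𝓢 ⊆ˡ 𝓗 × ⋃ 𝓢 ≡ X

⊆⋃ : ∀ {n} {𝓢 : Hypergraph n} {J} → J ∈ˡ 𝓢 → J ⊆ ⋃ 𝓢
⊆⋃ {𝓢 = K ∷ 𝓢} (here refl) = p⊆p∪q (⋃ 𝓢)
⊆⋃ {𝓢 = K ∷ 𝓢} (there J∈𝓢) = q⊆p∪q K (⋃ 𝓢) ∘ ⊆⋃ J∈𝓢

∈⋃⁻ : ∀ {n} (𝓢 : Hypergraph n) {v} → v ∈ ⋃ 𝓢 → ∃ λ J → J ∈ˡ 𝓢 × v ∈ J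
∈⋃⁻ []      v∈⊥ = contradiction v∈⊥ ∉⊥
∈⋃⁻ (K ∷ 𝓢) v∈⋃ with x∈p∪q⁻ K (⋃ 𝓢) v∈⋃
... | inj₁ v∈K = K , here refl , v∈K
... | inj₂ v∈  = let J , J∈𝓢 , v∈J = ∈⋃⁻ 𝓢 v∈ in J , there J∈𝓢 , v∈J

⋃⊆ : ∀ {n} (𝓢 : Hypergraph n) {X} → (∀ {J} → J ∈ˡ 𝓢 → J ⊆ X) → ⋃ 𝓢 ⊆ X
⋃⊆ 𝓢 sub v∈⋃ = let J , J∈𝓢 , v∈J = ∈⋃⁻ 𝓢 v∈⋃ in sub J∈𝓢 v∈J

⋂⊆ : ∀ {n} {𝓢 : Hypergraph n} {J} → J ∈ˡ 𝓢 → ⋂ 𝓢 ⊆ J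
⋂⊆ {𝓢 = K ∷ 𝓢} (here refl) = p∩q⊆p K (⋂ 𝓢)
⋂⊆ {𝓢 = K ∷ 𝓢} (there J∈𝓢) = ⋂⊆ J∈𝓢 ∘ p∩q⊆q K (⋂ 𝓢)

⊆⋂ : ∀ {n} (𝓢 : Hypergraph n) {X} → (∀ {J} → J ∈ˡ 𝓢 → X ⊆ J) → X ⊆ ⋂ 𝓢
⊆⋂ []      sub _   = ∈⊤
⊆⋂ (K ∷ 𝓢) sub v∈X = x∈p∩q⁺ (sub (here refl) v∈X , ⊆⋂ 𝓢 (sub ∘ there) v∈X)

unionClosure? : ∀ {n} (𝓗 : Hypergraph n) → Decidable (UnionClosure 𝓗)
unionClosure? 𝓗 X = map′ to from (⋃ below ≟ˢ X)
  where
  below = filter (_⊆? X) 𝓗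

  to : ⋃ below ≡ X → UnionClosure 𝓗 X
  to ⋃≡X = below , proj₁ ∘ ∈-filter⁻ (_⊆? X) , ⋃≡X

  from : UnionClosure 𝓗 X → ⋃ below ≡ X
  from (𝓢 , 𝓢⊆𝓗 , refl) = ⊆-antisym
    (⋃⊆ below (proj₂ ∘ ∈-filter⁻ (_⊆? X) {xs = 𝓗}))
    (⋃⊆ 𝓢 (λ J∈𝓢 → ⊆⋃ (∈-filter⁺ (_⊆? X) (𝓢⊆𝓗 J∈𝓢) (⊆⋃ J∈𝓢))))

------------------------------------------------------------------------
-- Boolean functions and definite Horn functions

BoolFun : ℕ → Set
BoolFun n = Subset n → Bool

TrueSet FalseSet : ∀ {n} → BoolFun n → Pred (Subset n) 0ℓ
TrueSet  f Z = f Z ≡ true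
FalseSet f Z = f Z ≡ false

infix 4 _≤_

_≤_ : ∀ {n} → BoolFun n → BoolFun n → Set
f ≤ g = ∀ X → f X Bool.≤ g X

-- head ∉ body already forces body ≢ ⊤.
record Clause (n : ℕ) : Set where
  constructor clause
  field
    body      : Subset n
    head      : Fin n
    head∉body : head ∉ body

open Clause public

infix 4 _⊨_ _⊨?_

_⊨_ : ∀ {n} → Subset n → Clause n → Set
T ⊨ c = body c ⊈ T ⊎ body c ∪ ⁅ head c ⁆ ⊆ T

_⊨?_ : ∀ {n} (T : Subset n) → Decidable (T ⊨_)
T ⊨? c = ¬? (body c ⊆? T) ⊎-dec (body c ∪ ⁅ head c ⁆ ⊆? T)

⟦_⟧ᶜ : ∀ {n} → Clause n → BoolFun n
⟦ c ⟧ᶜ T = does (T ⊨? c)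

CNF : ℕ → Set
CNF n = List (Clause n)

⟦_⟧ : ∀ {n} → CNF n → BoolFun n
⟦ φ ⟧ T = does (All.all? (T ⊨?_) φ)

DefiniteHorn : ∀ {n} → BoolFun n → Set
DefiniteHorn f = ∃ λ φ → f ≗ ⟦ φ ⟧

IsSmallestTrueSet : ∀ {n} → BoolFun n → Subset n → Pred (Subset n) 0ℓ
IsSmallestTrueSet f Z T =
  TrueSet f T × Z ⊆ T × (∀ T′ → TrueSet f T′ → Z ⊆ T′ → T ⊆ T′)

⟦⟧-true⁻ : ∀ {n} (φ : CNF n) {T} → ⟦ φ ⟧ T ≡ true → All (T ⊨_) φ
⟦⟧-true⁻ φ {T} eq with All.all? (T ⊨?_) φ | eq
... | yes all | _  = all
... | no _    | ()

⟦⟧-true⁺ : ∀ {n} (φ : CNF n) {T} → All (T ⊨_) φ → ⟦ φ ⟧ T ≡ true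
⟦⟧-true⁺ φ {T} = dec-true (All.all? (T ⊨?_) φ)

⋂-⊨ : ∀ {n} (c : Clause n) (𝓢 : Hypergraph n) → (∀ {T} → T ∈ˡ 𝓢 → T ⊨ c) → ⋂ 𝓢 ⊨ c
⋂-⊨ c 𝓢 sat with body c ⊆? ⋂ 𝓢
... | no  B⊈ = inj₁ B⊈
... | yes B⊆ = inj₂ (⊆⋂ 𝓢 step)
  where
  step : ∀ {T} → T ∈ˡ 𝓢 → body c ∪ ⁅ head c ⁆ ⊆ T
  step T∈𝓢 with sat T∈𝓢
  ... | inj₁ B⊈T  = contradiction (λ {x} → ⋂⊆ T∈𝓢 ∘ B⊆ {x}) B⊈T
  ... | inj₂ Bv⊆T = Bv⊆T

smallestTrueSet : ∀ {n} {f : BoolFun n} → DefiniteHorn f →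
                  ∀ Z → ∃! _≡_ (IsSmallestTrueSet f Z)
smallestTrueSet {n} {f} (φ , f≗φ) Z =
  ⋂ above ,
  (trans (f≗φ (⋂ above)) (⟦⟧-true⁺ φ (All.tabulate sat)) , ⊆⋂ above Z⊆ , least) ,
  λ {(fT , Z⊆T , T-least) → ⊆-antisym (least _ fT Z⊆T)
    (T-least _ (trans (f≗φ (⋂ above)) (⟦⟧-true⁺ φ (All.tabulate sat))) (⊆⋂ above Z⊆))}
  where
  above? : Decidable (λ T → TrueSet f T × Z ⊆ T)
  above? T = (f T Boolₚ.≟ true) ×-dec (Z ⊆? T)

  above : Hypergraph n
  above = filter above? (allSubsets n)

  true∧⊇ : ∀ {T} → T ∈ˡ above → TrueSet f T × Z ⊆ T
  true∧⊇ T∈ = proj₂ (∈-filter⁻ above? {xs = allSubsets n} T∈)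

  Z⊆ : ∀ {T} → T ∈ˡ above → Z ⊆ T
  Z⊆ T∈ = proj₂ (true∧⊇ T∈)

  least : ∀ T′ → TrueSet f T′ → Z ⊆ T′ → ⋂ above ⊆ T′
  least T′ fT′ Z⊆T′ = ⋂⊆ (∈-filter⁺ above? (∈-allSubsets T′) (fT′ , Z⊆T′))

  sat : ∀ {c} → c ∈ˡ φ → ⋂ above ⊨ c
  sat {c} c∈φ = ⋂-⊨ c above λ {T} T∈ →
    All.lookup (⟦⟧-true⁻ φ (trans (sym (f≗φ T)) (proj₁ (true∧⊇ T∈)))) c∈φ

𝕋 : ∀ {n} {f : BoolFun n} → DefiniteHorn f → Subset n → Subset n
𝕋 hf Z = proj₁ (smallestTrueSet hf Z)

------------------------------------------------------------------------
-- Hypergraph Horn functions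

x∉p-x : ∀ {n} (p : Subset n) x → x ∉ p - x
x∉p-x (_ ∷ p) (Fin.suc x) (Vec.there x∈) = x∉p-x p x x∈

-- (H ∖ {v}) → v
circularClause : ∀ {n} → Subset n → Fin n → Clause n
circularClause H v = clause (H - v) v (x∉p-x H v)

Φ : ∀ {n} → Hypergraph n → CNF n
Φ 𝓗 = concatMap (λ H → map (circularClause H) (filter (_∈? H) (allFin _))) 𝓗

HypergraphHorn : ∀ {n} → BoolFun n → Set
HypergraphHorn h = ∃ λ 𝓗 → h ≗ ⟦ Φ 𝓗 ⟧

------------------------------------------------------------------------
-- Implicate sets

Implicate : ∀ {n} → BoolFun n → Clause n → Set
Implicate f c = f ≤ ⟦ c ⟧ᶜ

implicate? : ∀ {n} (f : BoolFun n) → Decidable (Implicate f)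
implicate? f c = map′
  (λ all X → All.lookup all (∈-allSubsets X))
  (λ f≤c → All.tabulate (λ {X} _ → f≤c X))
  (All.all? (λ X → f X Boolₚ.≤? ⟦ c ⟧ᶜ X) (allSubsets _))

ImplicateSet : ∀ {n} → BoolFun n → Pred (Subset n) 0ℓ
ImplicateSet f I = ∀ {v} → v ∈ I → Implicate f (circularClause I v)

implicateSet? : ∀ {n} (f : BoolFun n) → Decidable (ImplicateSet f)
implicateSet? f I = Lift? (λ v → implicate? f (circularClause I v)) I

𝓘 : ∀ {n} → BoolFun n → Hypergraph n
𝓘 f = filter (implicateSet? f) (allSubsets _)

infix 10 _° _ⁱ

_° : ∀ {n} → BoolFun n → BoolFun n
f ° = ⟦ Φ (𝓘 f) ⟧

_ⁱ : ∀ {n} → BoolFun n → BoolFun n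
(f ⁱ) Z = does (Z ∈ˡ? map ∁ (𝓘 f))
  where open DecMembership _≟ˢ_ using () renaming (_∈?_ to _∈ˡ?_)

------------------------------------------------------------------------
-- The standard generator

others : ∀ {n} → BoolFun n → Subset n → Hypergraph n
others f I = filter (λ J → ¬? (J ≟ˢ I)) (𝓘 f)

𝓖 : ∀ {n} → BoolFun n → Hypergraph n
𝓖 f = filter (λ I → ¬? (unionClosure? (others f I) I)) (𝓘 f)

∈𝓘⁻ : ∀ {n} (f : BoolFun n) {I} → I ∈ˡ 𝓘 f → ImplicateSet f I
∈𝓘⁻ f I∈𝓘 = proj₂ (∈-filter⁻ (implicateSet? f) {xs = allSubsets _} I∈𝓘)

∈𝓘⁺ : ∀ {n} (f : BoolFun n) {I} → ImplicateSet f I → I ∈ˡ 𝓘 f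
∈𝓘⁺ f {I} = ∈-filter⁺ (implicateSet? f) (∈-allSubsets I)

⊨-circular-mono : ∀ {n} {J I X : Subset n} {v} → J ⊆ I →
                  X ⊨ circularClause J v → X ⊨ circularClause I v
⊨-circular-mono {J = J} {I} {X} {v} J⊆I sat with I - v ⊆? X
... | no  I-v⊈X = inj₁ I-v⊈X
... | yes I-v⊆X = inj₂ (go sat)
  where
  J-v⊆X : J - v ⊆ X
  J-v⊆X x∈ = I-v⊆X (x∈p∧x∉q⇒x∈p─q (J⊆I (p─q⊆p J ⁅ v ⁆ x∈))
    (λ x∈v → x∉p-x J v (subst (_∈ J - v) (x∈⁅y⁆⇒x≡y v x∈v) x∈)))

  go : X ⊨ circularClause J v → (I - v) ∪ ⁅ v ⁆ ⊆ X
  go (inj₁ J-v⊈X) = contradiction (λ {x} → J-v⊆X {x}) J-v⊈X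
  go (inj₂ Jv⊆X) x∈ with x∈p∪q⁻ (I - v) ⁅ v ⁆ x∈
  ... | inj₁ x∈I-v = I-v⊆X x∈I-v
  ... | inj₂ x∈v   = Jv⊆X (q⊆p∪q (J - v) ⁅ v ⁆ x∈v)

𝓘-⋃ : ∀ {n} (f : BoolFun n) (𝓢 : Hypergraph n) → 𝓢 ⊆ˡ 𝓘 f → ⋃ 𝓢 ∈ˡ 𝓘 f
𝓘-⋃ f 𝓢 𝓢⊆𝓘 = ∈𝓘⁺ f λ {v} v∈⋃ X →
  let J , J∈𝓢 , v∈J = ∈⋃⁻ 𝓢 v∈⋃
  in weaken (X ⊨? circularClause J v) (X ⊨? circularClause (⋃ 𝓢) v)
            (⊨-circular-mono (⊆⋃ J∈𝓢)) (∈𝓘⁻ f (𝓢⊆𝓘 J∈𝓢) v∈J X)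
  where
  weaken : ∀ {P Q : Set} (P? : Dec P) (Q? : Dec Q) → (P → Q) →
           ∀ {b} → b Bool.≤ does P? → b Bool.≤ does Q?
  weaken (no _)  Q?      P→Q Bool.b≤b = Boolₚ.≤-minimum _
  weaken (yes p) (yes _) P→Q _        = Boolₚ.≤-maximum _
  weaken (yes p) (no ¬q) P→Q _        = contradiction (P→Q p) ¬q

𝓖⊆𝓘 : ∀ {n} (f : BoolFun n) → 𝓖 f ⊆ˡ 𝓘 f
𝓖⊆𝓘 f = proj₁ ∘ ∈-filter⁻ (λ I → ¬? (unionClosure? (others f I) I))

-- With the next lemma: 𝓖 f is contained in every subfamily of 𝓘 f whose
-- union closure is 𝓘 f, and is itself such a subfamily, so it is the
-- unique minimal one.
𝓖-generates : ∀ {n} (f : BoolFun n) X → X ∈ˡ 𝓘 f ⇔ UnionClosure (𝓖 f) X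
𝓖-generates {n} f X = mk⇔ (to X (<-wellFounded ∣ X ∣)) from
  where
  irreducible? : Decidable (λ I → ¬ UnionClosure (others f I) I)
  irreducible? I = ¬? (unionClosure? (others f I) I)

  from : UnionClosure (𝓖 f) X → X ∈ˡ 𝓘 f
  from (𝓢 , 𝓢⊆𝓖 , refl) = 𝓘-⋃ f 𝓢 (𝓖⊆𝓘 f ∘ 𝓢⊆𝓖)

  to : ∀ Y → Acc ℕ._<_ ∣ Y ∣ → Y ∈ˡ 𝓘 f → UnionClosure (𝓖 f) Y
  to Y (acc rec) Y∈𝓘 with unionClosure? (others f Y) Y
  ... | no irreducible = Y ∷ [] ,
    (λ { (here refl) → ∈-filter⁺ irreducible? Y∈𝓘 irreducible }) , ∪-identityʳ Y
  ... | yes (𝓢 , 𝓢⊆ , ⋃𝓢≡Y) = below , proj₁ ∘ ∈-filter⁻ (_⊆? Y) ,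
    ⊆-antisym (⋃⊆ below (proj₂ ∘ ∈-filter⁻ (_⊆? Y) {xs = 𝓖 f})) Y⊆
    where
    below : Hypergraph n
    below = filter (_⊆? Y) (𝓖 f)

    ⊆Y : ∀ {J} → J ∈ˡ 𝓢 → J ⊆ Y
    ⊆Y {J} J∈𝓢 = subst (J ⊆_) ⋃𝓢≡Y (⊆⋃ J∈𝓢)

    smaller : ∀ {J} → J ⊆ Y → J ≢ Y → ∣ J ∣ ℕ.< ∣ Y ∣
    smaller {J} J⊆Y J≢Y with J ⊂? Y
    ... | yes J⊂Y = p⊂q⇒∣p∣<∣q∣ J⊂Y
    ... | no  J⊄Y = contradiction (⊆-antisym J⊆Y Y⊆J) J≢Y
      where
      Y⊆J : Y ⊆ J
      Y⊆J {x} x∈Y with x ∈? J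
      ... | yes x∈J = x∈J
      ... | no  x∉J = contradiction ((λ {y} → J⊆Y {y}) , x , x∈Y , x∉J) J⊄Y

    generated : ∀ {J} → J ∈ˡ 𝓢 → UnionClosure (𝓖 f) J
    generated {J} J∈𝓢 =
      let J∈𝓘 , J≢Y = ∈-filter⁻ (λ K → ¬? (K ≟ˢ Y)) {xs = 𝓘 f} (𝓢⊆ J∈𝓢)
      in to J (rec (smaller (⊆Y J∈𝓢) J≢Y)) J∈𝓘

    Y⊆ : Y ⊆ ⋃ below
    Y⊆ {v} v∈Y with ∈⋃⁻ 𝓢 (subst (v ∈_) (sym ⋃𝓢≡Y) v∈Y)
    ... | J , J∈𝓢 , v∈J with generated J∈𝓢
    ... | 𝓢J , 𝓢J⊆𝓖 , refl =
      let K , K∈ , v∈K = ∈⋃⁻ 𝓢J v∈J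
      in ⊆⋃ (∈-filter⁺ (_⊆? Y) (𝓢J⊆𝓖 K∈) (⊆Y J∈𝓢 ∘ ⊆⋃ K∈)) v∈K

𝓖-least : ∀ {n} (f : BoolFun n) (𝓗 : Hypergraph n) → 𝓗 ⊆ˡ 𝓘 f →
          (∀ X → X ∈ˡ 𝓘 f ⇔ UnionClosure 𝓗 X) → 𝓖 f ⊆ˡ 𝓗
𝓖-least f 𝓗 𝓗⊆𝓘 gen {I} I∈𝓖
  with ∈-filter⁻ (λ J → ¬? (unionClosure? (others f J) J)) {xs = 𝓘 f} I∈𝓖
... | I∈𝓘 , irreducible with Equivalence.to (gen I) I∈𝓘
... | 𝓢 , 𝓢⊆𝓗 , ⋃𝓢≡I with Any.any? (I ≟ˢ_) 𝓢
... | yes I∈𝓢 = 𝓢⊆𝓗 I∈𝓢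
... | no  I∉𝓢 = contradiction (𝓢 , (λ {J} → 𝓢⊆others {J}) , ⋃𝓢≡I) irreducible
  where
  𝓢⊆others : 𝓢 ⊆ˡ others f I
  𝓢⊆others J∈𝓢 = ∈-filter⁺ (λ J → ¬? (J ≟ˢ I)) (𝓗⊆𝓘 (𝓢⊆𝓗 J∈𝓢))
    (λ J≡I → I∉𝓢 (subst (_∈ˡ 𝓢) J≡I J∈𝓢))

{-# OPTIONS --safe #-}
-- A set X satisfies the circular clauses of I exactly when ∣ I ─ X ∣ ≢ 1, so
-- f ° X ≡ true means that no implicate set has exactly one element outside X.
-- This links (i), (ii), (iv), (v).  Since ∁ W ─ ∁ I ≡ I ─ W, unfolding ⁱ twice
-- gives f ⁱ ⁱ ≗ f °, hence (iii).  For (vi) ⇒ (iv), by induction on ∣ F ∣: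
-- unless some implicate set already works for F, the set F ∪ ⁅ u ⁆ is one.
module Submission where

open import Defs
open import Data.Bool.Base as Bool using (true; false)
open import Data.Bool.Properties using (⇔→≡; ≤-minimum; ≤-maximum)
open import Data.Fin.Base using (Fin; zero; suc)
import Data.Fin.Properties as Fin
open import Data.Fin.Subset
  using (Subset; _∈_; _∉_; _⊆_; _∪_; _─_; _-_; ⁅_⁆; ∣_∣; ⊥; ∁; inside; outside)
open import Data.Fin.Subset.Properties
open import Data.List.Base using (map; filter; allFin)
import Data.List.Membership.DecPropositional as DecMembership
open import Data.List.Membership.Propositional using (find; lose) renaming (_∈_ to _∈ˡ_)
open import Data.List.Membership.Propositional.Properties
  using (∈-map⁺; ∈-map⁻; ∈-filter⁺; ∈-filter⁻; ∈-concatMap⁺; ∈-concatMap⁻; ∈-allFin)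
import Data.List.Relation.Unary.All as All
import Data.List.Relation.Unary.Any as Any
open import Data.Nat.Base as ℕ using (ℕ)
import Data.Nat.Properties as ℕ
open import Data.Nat.Induction using (<-wellFounded)
open import Data.Product.Base using (∃; _×_; _,_; proj₁; proj₂)
open import Data.Sum.Base using (inj₁; inj₂)
open import Data.Vec.Base using ([]; _∷_; here; there)
open import Function.Base using (_∘_; case_of_)
open import Function.Bundles using (_⇔_; mk⇔; module Equivalence)
open import Function.Properties.Equivalence using () renaming (trans to ⇔-trans)
open import Induction.WellFounded using (Acc; acc)
open import Relation.Binary.PropositionalEquality
  using (_≡_; _≢_; _≗_; refl; sym; trans; cong; subst)
open import Relation.Nullary.Decidable using (Dec; does; yes; no; dec-true)
open import Relation.Nullary.Negation using (¬_; contradiction)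

open Equivalence using (to; from)

private
  variable
    n : ℕ

-- Subsets: differences, singletons, complements.

x∈p─q⇒x∉q : ∀ (p q : Subset n) {x} → x ∈ p ─ q → x ∉ q
x∈p─q⇒x∉q (_ ∷ p) (inside ∷ q) ()         here
x∈p─q⇒x∉q (_ ∷ p) (_ ∷ q)      (there x∈) (there x∈q) = x∈p─q⇒x∉q p q x∈ x∈q

∣p∣≡0⇒p≡⊥ : ∀ (p : Subset n) → ∣ p ∣ ≡ 0 → p ≡ ⊥
∣p∣≡0⇒p≡⊥ []            _  = refl
∣p∣≡0⇒p≡⊥ (outside ∷ p) eq = cong (outside ∷_) (∣p∣≡0⇒p≡⊥ p eq)

∣p∣≡1⇒p≡⁅x⁆ : ∀ (p : Subset n) → ∣ p ∣ ≡ 1 → ∃ λ x → p ≡ ⁅ x ⁆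
∣p∣≡1⇒p≡⁅x⁆ (inside  ∷ p) eq =
  zero , cong (inside ∷_) (∣p∣≡0⇒p≡⊥ p (ℕ.suc-injective eq))
∣p∣≡1⇒p≡⁅x⁆ (outside ∷ p) eq =
  let x , p≡⁅x⁆ = ∣p∣≡1⇒p≡⁅x⁆ p eq in suc x , cong (outside ∷_) p≡⁅x⁆

∁-involutive : ∀ (p : Subset n) → ∁ (∁ p) ≡ p
∁-involutive []            = refl
∁-involutive (inside  ∷ p) = cong (inside ∷_) (∁-involutive p)
∁-involutive (outside ∷ p) = cong (outside ∷_) (∁-involutive p)

-- Complementation swaps the two sides of a difference; this is the symmetry behind `ⁱⁱ≗°`.
∁p─∁q≡q─p : ∀ (p q : Subset n) → ∁ p ─ ∁ q ≡ q ─ p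
∁p─∁q≡q─p []            []            = refl
∁p─∁q≡q─p (inside  ∷ p) (inside  ∷ q) = cong (outside ∷_) (∁p─∁q≡q─p p q)
∁p─∁q≡q─p (inside  ∷ p) (outside ∷ q) = cong (outside ∷_) (∁p─∁q≡q─p p q)
∁p─∁q≡q─p (outside ∷ p) (inside  ∷ q) = cong (inside ∷_) (∁p─∁q≡q─p p q)
∁p─∁q≡q─p (outside ∷ p) (outside ∷ q) = cong (outside ∷_) (∁p─∁q≡q─p p q)

-- Circular clauses and their violation.

record SoleMissing (I X : Subset n) (v : Fin n) : Set where
  constructor soleMissing
  field
    ∈I     : v ∈ I
    ∉X     : v ∉ X
    unique : ∀ {w} → w ∈ I → w ∉ X → w ≡ v

open SoleMissing

sole⇒∣─∣≡1 : ∀ {I X : Subset n} {v} → SoleMissing I X v → ∣ I ─ X ∣ ≡ 1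
sole⇒∣─∣≡1 {I = I} {X} {v} s = trans (cong ∣_∣ (⊆-antisym ⊆v v⊆)) (∣⁅x⁆∣≡1 v)
  where
  ⊆v : I ─ X ⊆ ⁅ v ⁆
  ⊆v x∈ = from x∈⁅y⁆⇔x≡y (unique s (p─q⊆p I X x∈) (x∈p─q⇒x∉q I X x∈))

  v⊆ : ⁅ v ⁆ ⊆ I ─ X
  v⊆ x∈v = subst (_∈ I ─ X) (sym (x∈⁅y⁆⇒x≡y v x∈v)) (x∈p∧x∉q⇒x∈p─q (∈I s) (∉X s))

∣─∣≡1⇒sole : ∀ (I X : Subset n) → ∣ I ─ X ∣ ≡ 1 → ∃ (SoleMissing I X)
∣─∣≡1⇒sole I X eq with ∣p∣≡1⇒p≡⁅x⁆ (I ─ X) eq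
... | v , I─X≡⁅v⁆ = v , soleMissing (p─q⊆p I X v∈) (x∈p─q⇒x∉q I X v∈)
  λ {w} w∈I w∉X → x∈⁅y⁆⇒x≡y v (subst (w ∈_) I─X≡⁅v⁆ (x∈p∧x∉q⇒x∈p─q w∈I w∉X))
  where
  v∈ : v ∈ I ─ X
  v∈ = subst (v ∈_) (sym I─X≡⁅v⁆) (x∈⁅x⁆ v)

-- The clause fails at `X` exactly when `X` contains `I - v` but not `v`; for `v` in `I` this makes
-- `v` the one element of `I` outside `X`.
⊨-circular : ∀ {I X : Subset n} {v} → v ∈ I →
             X ⊨ circularClause I v ⇔ (¬ SoleMissing I X v)
⊨-circular {I = I} {X} {v} v∈I = mk⇔ sat⇒ ⇒sat
  where
  sat⇒ : X ⊨ circularClause I v → ¬ SoleMissing I X v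
  sat⇒ (inj₁ I-v⊈X) s = I-v⊈X λ {w} w∈I-v → case w ∈? X of λ where
    (yes w∈X) → w∈X
    (no  w∉X) → contradiction
      (subst (_∈ I - v) (unique s (p─q⊆p I ⁅ v ⁆ w∈I-v) w∉X) w∈I-v) (x∉p-x I v)
  sat⇒ (inj₂ Iv⊆X) s = ∉X s (Iv⊆X (q⊆p∪q (I - v) ⁅ v ⁆ (x∈⁅x⁆ v)))

  ⇒sat : ¬ SoleMissing I X v → X ⊨ circularClause I v
  ⇒sat ¬s with I - v ⊆? X | v ∈? X
  ... | no  I-v⊈X | _       = inj₁ I-v⊈X
  ... | yes I-v⊆X | yes v∈X = inj₂ λ x∈ → case x∈p∪q⁻ (I - v) ⁅ v ⁆ x∈ of λ where
    (inj₁ x∈I-v) → I-v⊆X x∈I-v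
    (inj₂ x∈v)   → subst (_∈ X) (sym (x∈⁅y⁆⇒x≡y v x∈v)) v∈X
  ... | yes I-v⊆X | no  v∉X = contradiction (soleMissing v∈I v∉X uniq) ¬s
    where
    uniq : ∀ {w} → w ∈ I → w ∉ X → w ≡ v
    uniq {w} w∈I w∉X with w Fin.≟ v
    ... | yes w≡v = w≡v
    ... | no  w≢v = contradiction (I-v⊆X (x∈p∧x∉q⇒x∈p─q w∈I (x≢y⇒x∉⁅y⁆ w≢v))) w∉X

-- A violated clause of `H` is the same data as a sole missing element of `H`, so all heads of one
-- `H` merge into a condition on the size of `H ─ X`.
⟦Φ⟧-true : ∀ (𝓗 : Hypergraph n) X →
           ⟦ Φ 𝓗 ⟧ X ≡ true ⇔ (∀ {H} → H ∈ˡ 𝓗 → ∣ H ─ X ∣ ≢ 1)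
⟦Φ⟧-true {n} 𝓗 X = mk⇔ true⇒ ⇒true
  where
  clauses : Subset n → CNF n
  clauses H = map (circularClause H) (filter (_∈? H) (allFin n))

  true⇒ : ⟦ Φ 𝓗 ⟧ X ≡ true → ∀ {H} → H ∈ˡ 𝓗 → ∣ H ─ X ∣ ≢ 1
  true⇒ ΦX {H} H∈𝓗 eq with ∣─∣≡1⇒sole H X eq
  ... | v , s = to (⊨-circular (∈I s)) (All.lookup (⟦⟧-true⁻ (Φ 𝓗) ΦX) c∈Φ) s
    where
    c∈Φ : circularClause H v ∈ˡ Φ 𝓗
    c∈Φ = ∈-concatMap⁺ clauses
      (lose H∈𝓗 (∈-map⁺ (circularClause H) (∈-filter⁺ (_∈? H) (∈-allFin v) (∈I s))))

  ⇒true : (∀ {H} → H ∈ˡ 𝓗 → ∣ H ─ X ∣ ≢ 1) → ⟦ Φ 𝓗 ⟧ X ≡ true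
  ⇒true ≢1 = ⟦⟧-true⁺ (Φ 𝓗) (All.tabulate sat)
    where
    sat : ∀ {c} → c ∈ˡ Φ 𝓗 → X ⊨ c
    sat c∈Φ with find (∈-concatMap⁻ clauses {xs = 𝓗} c∈Φ)
    ... | H , H∈𝓗 , c∈ with ∈-map⁻ (circularClause H) c∈
    ... | v , v∈ , refl =
      from (⊨-circular (proj₂ (∈-filter⁻ (_∈? H) {xs = allFin n} v∈)))
           (≢1 H∈𝓗 ∘ sole⇒∣─∣≡1)

-- Implicate sets, `f °` and the implicate-dual.

true≤does⇒ : ∀ {P : Set} (P? : Dec P) → true Bool.≤ does P? → P
true≤does⇒ (yes p) _ = p
true≤does⇒ (no _)  ()

-- With `°-true` this exhibits a Galois connection for the relation `∣ I ─ X ∣ ≢ 1`: `𝓘 f` is the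
-- polar of the true sets of `f`, and the true sets of `f °` are the polar of `𝓘 f`.
∈𝓘⇔ : ∀ (f : BoolFun n) I → I ∈ˡ 𝓘 f ⇔ (∀ {X} → TrueSet f X → ∣ I ─ X ∣ ≢ 1)
∈𝓘⇔ f I = mk⇔ ∈⇒ (λ ≢1 → ∈𝓘⁺ f (λ {v} → implicate ≢1 {v}))
  where
  ∈⇒ : I ∈ˡ 𝓘 f → ∀ {X} → TrueSet f X → ∣ I ─ X ∣ ≢ 1
  ∈⇒ I∈𝓘 {X} fX eq with ∣─∣≡1⇒sole I X eq
  ... | v , s = to (⊨-circular (∈I s))
    (true≤does⇒ (X ⊨? circularClause I v)
      (subst (Bool._≤ _) fX (∈𝓘⁻ f I∈𝓘 (∈I s) X))) s

  implicate : (∀ {X} → TrueSet f X → ∣ I ─ X ∣ ≢ 1) → ImplicateSet f I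
  implicate ≢1 {v} v∈I X with f X in fX
  ... | false = ≤-minimum _
  ... | true  rewrite dec-true (X ⊨? circularClause I v)
                        (from (⊨-circular v∈I) (≢1 fX ∘ sole⇒∣─∣≡1)) = ≤-maximum _

°-true : ∀ (f : BoolFun n) X → (f °) X ≡ true ⇔ (∀ {I} → I ∈ˡ 𝓘 f → ∣ I ─ X ∣ ≢ 1)
°-true f = ⟦Φ⟧-true (𝓘 f)

ⁱ-true : ∀ (f : BoolFun n) Z → (f ⁱ) Z ≡ true ⇔ ∁ Z ∈ˡ 𝓘 f
ⁱ-true {n} f Z = mk⇔ true⇒ ⇒true
  where
  open DecMembership (_≟ˢ_ {n}) using () renaming (_∈?_ to _∈ˡ?_)

  true⇒ : (f ⁱ) Z ≡ true → ∁ Z ∈ˡ 𝓘 f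
  true⇒ eq with Z ∈ˡ? map ∁ (𝓘 f) | eq
  ... | yes Z∈ | _ = let I , I∈𝓘 , Z≡∁I = ∈-map⁻ ∁ Z∈ in
    subst (_∈ˡ 𝓘 f) (sym (trans (cong ∁ Z≡∁I) (∁-involutive I))) I∈𝓘
  ... | no  _  | ()

  ⇒true : ∁ Z ∈ˡ 𝓘 f → (f ⁱ) Z ≡ true
  ⇒true ∁Z∈𝓘 = dec-true (Z ∈ˡ? map ∁ (𝓘 f))
    (subst (_∈ˡ map ∁ (𝓘 f)) (∁-involutive Z) (∈-map⁺ ∁ ∁Z∈𝓘))

-- The true sets of `f ⁱ` are the `∁ I` with `I` in `𝓘 f`. So `W` is true for the double dual when
-- no `∁ W ─ ∁ I` is a singleton, and the complement identity turns this into `°-true`.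
ⁱⁱ≗° : ∀ (f : BoolFun n) → (f ⁱ) ⁱ ≗ f °
ⁱⁱ≗° f W = ⇔→≡ (mk⇔
  (λ eq → from (°-true f W) λ {I} I∈𝓘 →
    subst (λ p → ∣ p ∣ ≢ 1) (∁p─∁q≡q─p W I)
      (to (∈𝓘⇔ (f ⁱ) (∁ W)) (to (ⁱ-true (f ⁱ) W) eq)
        (from (ⁱ-true f (∁ I)) (subst (_∈ˡ 𝓘 f) (sym (∁-involutive I)) I∈𝓘))))
  (λ eq → from (ⁱ-true (f ⁱ) W) (from (∈𝓘⇔ (f ⁱ) (∁ W)) λ {Z} fⁱZ →
    subst (λ p → ∣ p ∣ ≢ 1)
      (trans (sym (∁p─∁q≡q─p W (∁ Z))) (cong (∁ W ─_) (∁-involutive Z)))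
      (to (°-true f W) eq (to (ⁱ-true f Z) fⁱZ)))))

f≤f° : ∀ (f : BoolFun n) {X} → TrueSet f X → TrueSet (f °) X
f≤f° f fX = from (°-true f _) λ I∈𝓘 → to (∈𝓘⇔ f _) I∈𝓘 fX

-- Fixed points of `°` and detection of false sets.

hypergraphHorn⇔°≗ : ∀ (f : BoolFun n) → HypergraphHorn f ⇔ (f ° ≗ f)
hypergraphHorn⇔°≗ f = mk⇔ horn⇒ λ f°≗f → 𝓘 f , sym ∘ f°≗f
  where
  horn⇒ : HypergraphHorn f → f ° ≗ f
  horn⇒ (𝓗 , f≗Φ) X = ⇔→≡ (mk⇔
    (λ f°X → trans (f≗Φ X) (from (⟦Φ⟧-true 𝓗 X) (to (°-true f X) f°X ∘ 𝓗⊆𝓘)))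
    (f≤f° f))
    where
    -- Hence `f °` obeys every constraint of `Φ 𝓗`, which gives the inequality opposite to `f≤f°`.
    𝓗⊆𝓘 : ∀ {H} → H ∈ˡ 𝓗 → H ∈ˡ 𝓘 f
    𝓗⊆𝓘 H∈𝓗 = from (∈𝓘⇔ f _) λ {T} fT → to (⟦Φ⟧-true 𝓗 T) (trans (sym (f≗Φ T)) fT) H∈𝓗

FalseSetsDetectedBy : BoolFun n → Hypergraph n → Set
FalseSetsDetectedBy f 𝓗 = ∀ F → FalseSet f F → ∃ λ I → I ∈ˡ 𝓗 × ∣ I ─ F ∣ ≡ 1

-- By `f≤f°`, equality can fail only at a false set of `f` that is true for `f °`, which is one that
-- no implicate set detects.
°≗⇔detected : ∀ (f : BoolFun n) → (f ° ≗ f) ⇔ FalseSetsDetectedBy f (𝓘 f)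
°≗⇔detected f = mk⇔ ≗⇒ ⇒≗
  where
  ≗⇒ : f ° ≗ f → FalseSetsDetectedBy f (𝓘 f)
  ≗⇒ f°≗f F fF with Any.any? (λ I → ∣ I ─ F ∣ ℕ.≟ 1) (𝓘 f)
  ... | yes any = find any
  ... | no ¬any = contradiction
    (trans (sym (trans (f°≗f F) fF)) (from (°-true f F) λ I∈𝓘 eq → ¬any (lose I∈𝓘 eq))) λ ()

  ⇒≗ : FalseSetsDetectedBy f (𝓘 f) → f ° ≗ f
  ⇒≗ detect X with f X in fX
  ... | true  = f≤f° f fX
  ... | false with (f °) X in f°X
  ...   | false = refl
  ...   | true  = let I , I∈𝓘 , eq = detect X fX in
    contradiction eq (to (°-true f X) f°X I∈𝓘)

-- A detecting `I` is a union of members of `𝓖 f`. A member containing the sole missing element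
-- detects too: it lies inside `I`, so nothing else of it is outside `F`.
𝓘-detects⇔𝓖-detects : ∀ (f : BoolFun n) →
                      FalseSetsDetectedBy f (𝓘 f) ⇔ FalseSetsDetectedBy f (𝓖 f)
𝓘-detects⇔𝓖-detects f = mk⇔ refine
  λ detect F fF → let I , I∈𝓖 , eq = detect F fF in I , 𝓖⊆𝓘 f I∈𝓖 , eq
  where
  refine : FalseSetsDetectedBy f (𝓘 f) → FalseSetsDetectedBy f (𝓖 f)
  refine detect F fF with detect F fF
  ... | I , I∈𝓘 , eq with ∣─∣≡1⇒sole I F eq | to (𝓖-generates f I) I∈𝓘
  ... | v , s | 𝓢 , 𝓢⊆𝓖 , refl =
    let J , J∈𝓢 , v∈J = ∈⋃⁻ 𝓢 (∈I s)
    in J , 𝓢⊆𝓖 J∈𝓢 , sole⇒∣─∣≡1 (soleMissing v∈J (∉X s) (unique s ∘ ⊆⋃ J∈𝓢))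

-- The exchange condition on smallest true sets.

soleMissing-forced : ∀ {f : BoolFun n} {I X Y v} → I ∈ˡ 𝓘 f → SoleMissing I X v →
                     X ⊆ Y → TrueSet f Y → v ∈ Y
soleMissing-forced {f = f} {I} {X} {Y} {v} I∈𝓘 s X⊆Y fY with v ∈? Y
... | yes v∈Y = v∈Y
-- Enlarging `X` to `Y` without gaining `v` keeps `v` the sole missing element, which an implicate
-- set forbids at a true set.
... | no  v∉Y = contradiction
  (sole⇒∣─∣≡1 (soleMissing (∈I s) v∉Y λ w∈I w∉Y → unique s w∈I (w∉Y ∘ X⊆Y)))
  (to (∈𝓘⇔ f I) I∈𝓘 fY)

module _ {f : BoolFun n} (hf : DefiniteHorn f) where

  𝕋-true : ∀ Z → TrueSet f (𝕋 hf Z)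
  𝕋-true Z = proj₁ (proj₁ (proj₂ (smallestTrueSet hf Z)))

  ⊆𝕋 : ∀ Z → Z ⊆ 𝕋 hf Z
  ⊆𝕋 Z = proj₁ (proj₂ (proj₁ (proj₂ (smallestTrueSet hf Z))))

  𝕋-least : ∀ {Z T} → TrueSet f T → Z ⊆ T → 𝕋 hf Z ⊆ T
  𝕋-least {Z} {T} = proj₂ (proj₂ (proj₁ (proj₂ (smallestTrueSet hf Z)))) T

  Exchangeable : Subset n → Fin n → Set
  Exchangeable F u = u ∈ 𝕋 hf F ─ F ×
    (∀ v → v ∈ F → TrueSet f (F - v) → v ∈ 𝕋 hf ((F - v) ∪ ⁅ u ⁆))

  -- The witness `u` is the one element of the detecting `I` outside `F`. Trading `v` for `u` in `F`
  -- makes `v` the sole missing element, so it is forced in turn.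
  detected⇒exchangeable : FalseSetsDetectedBy f (𝓘 f) →
                          ∀ F → FalseSet f F → ∃ (Exchangeable F)
  detected⇒exchangeable detect F fF with detect F fF
  ... | I , I∈𝓘 , eq with ∣─∣≡1⇒sole I F eq
  ... | u , s = u ,
    x∈p∧x∉q⇒x∈p─q (soleMissing-forced I∈𝓘 s (⊆𝕋 F) (𝕋-true F)) (∉X s) , exchange
    where
    exchange : ∀ v → v ∈ F → TrueSet f (F - v) → v ∈ 𝕋 hf ((F - v) ∪ ⁅ u ⁆)
    exchange v v∈F fF-v = soleMissing-forced I∈𝓘 sole (⊆𝕋 F-v+u) (𝕋-true F-v+u)
      where
      F-v+u : Subset n
      F-v+u = (F - v) ∪ ⁅ u ⁆

      unique′ : ∀ {w} → w ≢ v → w ∈ I → w ∉ F - v → w ≡ u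
      unique′ w≢v w∈I w∉ =
        unique s w∈I λ w∈F → w∉ (x∈p∧x∉q⇒x∈p─q w∈F (x≢y⇒x∉⁅y⁆ w≢v))

      -- If `v` were not in `I`, then `u` would remain the sole missing element at the true set
      -- `F - v`.
      v∈I : v ∈ I
      v∈I with v ∈? I
      ... | yes v∈I = v∈I
      ... | no  v∉I = contradiction
        (sole⇒∣─∣≡1 (soleMissing (∈I s) (∉X s ∘ p─q⊆p F ⁅ v ⁆)
          λ w∈I → unique′ (λ { refl → v∉I w∈I }) w∈I))
        (to (∈𝓘⇔ f I) I∈𝓘 fF-v)

      sole : SoleMissing I F-v+u v
      sole = soleMissing v∈I
        (λ v∈ → case x∈p∪q⁻ (F - v) ⁅ u ⁆ v∈ of λ where
          (inj₁ v∈F-v) → x∉p-x F v v∈F-v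
          (inj₂ v∈u)   → ∉X s (subst (_∈ F) (x∈⁅y⁆⇒x≡y u v∈u) v∈F))
        uniq
        where
        uniq : ∀ {w} → w ∈ I → w ∉ F-v+u → w ≡ v
        uniq {w} w∈I w∉ with w Fin.≟ v
        ... | yes w≡v = w≡v
        ... | no  w≢v = contradiction
          (q⊆p∪q (F - v) ⁅ u ⁆ (from x∈⁅y⁆⇔x≡y (unique′ w≢v w∈I (w∉ ∘ p⊆p∪q ⁅ u ⁆)))) w∉

  -- Suppose a true set `X` misses only `v` from `F ∪ ⁅ u ⁆`. If `v` is in `F`, then `X` contains
  -- the exchanged set and hence `v`; if `v` is `u`, then `X` contains `F` and hence `𝕋 hf F`, where
  -- `u` lies.
  add-implicateSet : ∀ {F u} → u ∈ 𝕋 hf F ─ F →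
                     (∀ {v} → v ∈ F → v ∈ 𝕋 hf ((F - v) ∪ ⁅ u ⁆)) → F ∪ ⁅ u ⁆ ∈ˡ 𝓘 f
  add-implicateSet {F} {u} u∈ exchange = from (∈𝓘⇔ f _) λ {X} → ≢1 {X}
    where
    ≢1 : ∀ {X} → TrueSet f X → ∣ F ∪ ⁅ u ⁆ ─ X ∣ ≢ 1
    ≢1 {X} fX eq with ∣─∣≡1⇒sole (F ∪ ⁅ u ⁆) X eq
    ... | v , s with v ∈? F
    ...   | yes v∈F = ∉X s (𝕋-least fX ⊆X (exchange v∈F))
      where
      ⊆X : (F - v) ∪ ⁅ u ⁆ ⊆ X
      ⊆X {w} w∈ with w ∈? X
      ... | yes w∈X = w∈X
      ... | no  w∉X with x∈p∪q⁻ (F - v) ⁅ u ⁆ w∈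
      ...   | inj₁ w∈F-v = contradiction
        (subst (_∈ F - v) (unique s (p⊆p∪q ⁅ u ⁆ (p─q⊆p F ⁅ v ⁆ w∈F-v)) w∉X) w∈F-v)
        (x∉p-x F v)
      -- Here `w` equals both `u` and `v`, which would put `u` in `F`.
      ...   | inj₂ w∈u = contradiction
        (subst (_∈ F)
          (trans (sym (unique s (q⊆p∪q F ⁅ u ⁆ w∈u) w∉X)) (x∈⁅y⁆⇒x≡y u w∈u)) v∈F)
        (x∈p─q⇒x∉q (𝕋 hf F) F u∈)
    ...   | no  v∉F with x∈p∪q⁻ F ⁅ u ⁆ (∈I s)
    ...     | inj₁ v∈F = v∉F v∈F
    ...     | inj₂ v∈u = ∉X s (subst (_∈ X) (sym (x∈⁅y⁆⇒x≡y u v∈u))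
      (𝕋-least fX F⊆X (p─q⊆p (𝕋 hf F) F u∈)))
      where
      F⊆X : F ⊆ X
      F⊆X {w} w∈F with w ∈? X
      ... | yes w∈X = w∈X
      ... | no  w∉X = contradiction
        (subst (_∈ F) (unique s (p⊆p∪q ⁅ u ⁆ w∈F) w∉X) w∈F) v∉F

  exchangeable⇒detected : (∀ F → FalseSet f F → ∃ (Exchangeable F)) →
                          FalseSetsDetectedBy f (𝓘 f)
  exchangeable⇒detected exchangeable F = detect F (<-wellFounded ∣ F ∣)
    where
    detect : ∀ F → Acc ℕ._<_ ∣ F ∣ → FalseSet f F → ∃ λ I → I ∈ˡ 𝓘 f × ∣ I ─ F ∣ ≡ 1
    -- The search comes first so that its failure `¬any` is available in `forced`.
    detect F (acc rec) fF with Any.any? (λ I → ∣ I ─ F ∣ ℕ.≟ 1) (𝓘 f)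
    ... | yes any = find any
    ... | no ¬any with exchangeable F fF
    ... | u , u∈ , exchange = F ∪ ⁅ u ⁆ , add-implicateSet u∈ forced , sole⇒∣─∣≡1 sole
      where
      -- If F - v is false, the set I detecting it cannot detect F, so v is the
      -- sole element of I outside F - v.
      forced : ∀ {v} → v ∈ F → v ∈ 𝕋 hf ((F - v) ∪ ⁅ u ⁆)
      forced {v} v∈F with f (F - v) in fF-v
      ... | true  = exchange v v∈F fF-v
      ... | false with detect (F - v) (rec (x∈p⇒∣p-x∣<∣p∣ v∈F)) fF-v
      ... | I , I∈𝓘 , eq with ∣─∣≡1⇒sole I (F - v) eq
      ... | w , s with w Fin.≟ v
      -- Every true set above `F - v` contains `v`, in particular the smallest one above
      -- `(F - v) ∪ ⁅ u ⁆`.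
      ...   | yes refl = soleMissing-forced I∈𝓘 s
        (⊆𝕋 ((F - v) ∪ ⁅ u ⁆) ∘ p⊆p∪q ⁅ u ⁆) (𝕋-true _)
      ...   | no  w≢v  = contradiction (lose I∈𝓘 (sole⇒∣─∣≡1 (soleMissing (∈I s)
        (λ w∈F → ∉X s (x∈p∧x∉q⇒x∈p─q w∈F (x≢y⇒x∉⁅y⁆ w≢v)))
        λ x∈I x∉F → unique s x∈I (x∉F ∘ p─q⊆p F ⁅ v ⁆)))) ¬any

      sole : SoleMissing (F ∪ ⁅ u ⁆) F u
      sole = soleMissing (q⊆p∪q F ⁅ u ⁆ (x∈⁅x⁆ u)) (x∈p─q⇒x∉q (𝕋 hf F) F u∈)
        λ w∈ w∉F → case x∈p∪q⁻ F ⁅ u ⁆ w∈ of λ where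
          (inj₁ w∈F) → contradiction w∈F w∉F
          (inj₂ w∈u) → x∈⁅y⁆⇒x≡y u w∈u

theorem11 : (n : ℕ) (f : BoolFun n) (hf : DefiniteHorn f) →
    (HypergraphHorn f ⇔ (f ° ≗ f)) ×
    (HypergraphHorn f ⇔ ((f ⁱ) ⁱ ≗ f)) ×
    (HypergraphHorn f ⇔
    ((F : Subset n) → FalseSet f F → ∃ λ I → I ∈ˡ 𝓘 f × ∣ I ─ F ∣ ≡ 1)) ×
    (HypergraphHorn f ⇔
    ((F : Subset n) → FalseSet f F → ∃ λ I → I ∈ˡ 𝓖 f × ∣ I ─ F ∣ ≡ 1)) ×
    (HypergraphHorn f ⇔
    ((F : Subset n) → FalseSet f F → ∃ λ (u : Fin n) → u ∈ 𝕋 hf F ─ F ×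
    ((v : Fin n) → v ∈ F → TrueSet f (F - v) →
    v ∈ 𝕋 hf ((F - v) ∪ ⁅ u ⁆))))
theorem11 n f hf =
  hypergraphHorn⇔°≗ f ,
  ⇔-trans (hypergraphHorn⇔°≗ f)
    (mk⇔ (λ f°≗f X → trans (ⁱⁱ≗° f X) (f°≗f X)) λ fⁱⁱ≗f X → trans (sym (ⁱⁱ≗° f X)) (fⁱⁱ≗f X)) ,
  horn⇔detected ,
  ⇔-trans horn⇔detected (𝓘-detects⇔𝓖-detects f) ,
  ⇔-trans horn⇔detected (mk⇔ (detected⇒exchangeable hf) (exchangeable⇒detected hf))
  where
  horn⇔detected : HypergraphHorn f ⇔ FalseSetsDetectedBy f (𝓘 f)
  horn⇔detected = ⇔-trans (hypergraphHorn⇔°≗ f) (°≗⇔detected f)
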